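{- Let $n, m, t$ be positive integers with $m=t+1$. There exists a $(t+1)$-color connected colored edge graph $G(V,E,C,f)$ with $|V|=n$ and $|C|=m$ if and only if $n\ge 2m$.
   Context: All graphs are finite, undirected and simple (no loops, no multiple edges). A colored edge graph is a tuple $G(V,E,C,f)$ where $(V,E)$ is a graph with node set $V$ and edge set $E$, $C$ is a finite set of colors, and $f:E\to C$ is a surjective map (each edge carries exactly one color; the coloring need not be proper). For an integer $t\ge 1$, two distinct nodes $A,B\in V$ are $(t+1)$-color connected if for every color set $C_t\subseteq C$ with $|C_t|=t$ there is a path from $A$ to $B$ in $G$ none of whose edges has a color in $C_t$. The colored edge graph $G$ is $(t+1)$-color connected if every two distinct nodes of $G$ are $(t+1)$-color connected. -}

module Defs where

open import Level using (0ℓ)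
open import Data.Nat using (ℕ)
open import Data.Fin using (Fin)
open import Data.Fin.Subset using (Subset; ∣_∣; _∉_)
open import Data.List using (List; []; _∷_)
open import Data.List.Relation.Unary.All using (All)
open import Data.List.Relation.Unary.Unique.Propositional using (Unique)
open import Data.Product using (Σ; ∃-syntax; _×_; proj₂)
open import Function.Definitions using (StrictlySurjective)
open import Relation.Binary.Core using (Rel)
open import Relation.Binary.Definitions using (Decidable; Irreflexive; Symmetric)
open import Relation.Binary.PropositionalEquality using (_≡_; _≢_)

-- Colored edge graphs with |V| = n and |C| = m; the node set is Fin n and
-- the color set is Fin m.
record ColoredEdgeGraph (n m : ℕ) : Set₁ where
  field
    Adj        : Rel (Fin n) 0ℓ
    adj?       : Decidable Adj
    adj-sym    : Symmetric Adj
    adj-irrefl : Irreflexive _≡_ Adj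

  -- Oriented edges: an undirected edge is represented by both orientations.
  Edge : Set
  Edge = Σ (Fin n) λ u → Σ (Fin n) λ v → Adj u v

  field
    color      : ∀ {u v} → Adj u v → Fin m
    -- The color belongs to the unordered pair {u , v}: together with adj-sym,
    -- this also makes it independent of the proof of adjacency.
    color-sym  : ∀ {u v} (e : Adj u v) (e′ : Adj v u) → color e ≡ color e′
    color-surj : StrictlySurjective {A = Edge} _≡_ (λ e → color (proj₂ (proj₂ e)))

module _ {n m : ℕ} (G : ColoredEdgeGraph n m) where
  open ColoredEdgeGraph G

  data Walk : Fin n → Fin n → Set where
    nil  : ∀ {u} → Walk u u
    cons : ∀ {u v w} → Adj u v → Walk v w → Walk u w

module _ {n m : ℕ} {G : ColoredEdgeGraph n m} where
  open ColoredEdgeGraph G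

  nodes : ∀ {u v} → Walk G u v → List (Fin n)
  nodes {u} nil        = u ∷ []
  nodes {u} (cons _ p) = u ∷ nodes p

  colors : ∀ {u v} → Walk G u v → List (Fin m)
  colors nil        = []
  colors (cons e p) = color e ∷ colors p

  IsPath : ∀ {u v} → Walk G u v → Set
  IsPath p = Unique (nodes p)

  Avoids : ∀ {u v} → Subset m → Walk G u v → Set
  Avoids S p = All (_∉ S) (colors p)

module _ {n m : ℕ} where

  -- The index is shifted: NodesColorConnected t and ColorConnected t are
  -- (t+1)-color connectedness.
  NodesColorConnected : ℕ → ColoredEdgeGraph n m → Fin n → Fin n → Set
  NodesColorConnected t G A B =
    (S : Subset m) → ∣ S ∣ ≡ t → ∃[ p ] (IsPath {G = G} {A} {B} p × Avoids S p)

  ColorConnected : ℕ → ColoredEdgeGraph n m → Set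
  ColorConnected t G = ∀ A B → A ≢ B → NodesColorConnected t G A B

{-# OPTIONS --safe #-}

-- With m = t + 1 colors, forbidding t of them leaves exactly one, so
-- (t+1)-color connectedness says that every color class is connected and
-- spanning.
--
-- Necessity: orient each color class towards node 0 along shortest walks. Every
-- node v ≠ 0 then owns the edge to its parent, so each class has at least n − 1
-- edges; counting both orientations, 2m(n − 1) ≤ n(n − 1).
--
-- Sufficiency: write a node as 2i + a with a ∈ {0 , 1}. The pair of distinct
-- nodes (i , a), (j , b) gets color min i j if a = b and max i j otherwise, and
-- is an edge if that color is below m. Color class k then contains the double
-- star with centers (k , 0) and (k , 1): these are adjacent, (j , a) is adjacent
-- to (k , a) if j > k, and to (k , 1 − a) if j < k.
module Submission where

open import Level using (0ℓ)
open import Data.Empty using (⊥-elim)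
open import Data.Nat using (ℕ; zero; suc; _+_; _*_; _∸_; _<_; _≤_; _≥_; _⊓_; _⊔_; z≤n; s≤s; ⌊_/2⌋; parity)
open import Data.Nat.Properties using
  ( ≤-refl; ≤-trans; ≤-reflexive; <-asym; <⇒≤; <⇒≱; <-cmp; _<?_
  ; +-comm; +-monoʳ-≤; *-monoˡ-≤; *-comm; *-cancelʳ-≤; m+n∸n≡m
  ; ⊓-comm; ⊔-comm; m≥n⇒m⊓n≡n; m≤n⇒m⊔n≡n; ⊔-idem )
open import Data.Parity using (Parity; 0ℙ; 1ℙ; _⁻¹)
open import Data.Fin using (Fin; zero; suc; fromℕ<; punchOut; toℕ)
open import Data.Fin.Properties using
  ( _≟_; any?; ¬∀⟶∃¬; punchOut-injective; injective⇒≤; *↔×; suc-injective; toℕ-injective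
  ; toℕ-fromℕ<; fromℕ<-toℕ; fromℕ<-cong; toℕ<n )
open import Data.Fin.Subset using (Subset; ∣_∣; _∉_; ∁; ⁅_⁆; ⊤)
open import Data.Fin.Subset.Properties using
  ( _∈?_; p⊆q⇒∣p∣≤∣q∣; ∣⊤∣≡n; ∣⁅x⁆∣≡1; ∣∁p∣≡n∸∣p∣; x∉∁p⇒x∈p; x∈⁅y⁆⇒x≡y )
open import Data.List.Membership.Propositional using (_∈_)
open import Data.List.Relation.Unary.Any using (here; there)
open import Data.List.Relation.Unary.All as All using (All; []; _∷_)
open import Data.List.Relation.Unary.All.Properties using (¬Any⇒All¬)
open import Data.List.Relation.Unary.AllPairs using ([]; _∷_)
open import Data.Product using (Σ-syntax; ∃-syntax; _×_; _,_; proj₁; proj₂)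
open import Data.Product.Properties using (,-injectiveˡ; ,-injectiveʳ)
open import Function using (_∘_)
open import Function.Bundles using (_⇔_; mk⇔; mk↣; module Injection)
open import Function.Construct.Composition using (_↣-∘_)
open import Data.Product.Function.NonDependent.Propositional using (_×-↔_)
open import Function.Properties.Inverse using (↔⇒↣; ↔-refl; ↔-sym; ↔-trans)
open import Function.Definitions using (Injective)
open import Relation.Binary.Core using (Rel)
open import Relation.Binary.Definitions using (Decidable; Symmetric; tri<; tri≈; tri>)
open import Relation.Binary.Construct.Closure.ReflexiveTransitive using (Star; ε; _◅_; _◅◅_; reverse)
open import Relation.Binary.PropositionalEquality using (_≡_; _≢_; refl; sym; trans; cong; cong₂; subst)
open import Relation.Nullary using (¬_; yes; no; contradiction)
open import Relation.Nullary.Decidable using (_×-dec_; ¬?)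
import Relation.Unary as Unary
import Data.List.Membership.DecPropositional as DecMembership
open import Defs

-- Shortest walks to a root.

least : {P : ℕ → Set} → Unary.Decidable P → ∀ L → P L → ∃[ l ] (P l × ∀ j → P j → l ≤ j)
least P? zero    p = zero , p , λ _ _ → z≤n
least P? (suc L) p with P? zero
... | yes p₀ = zero , p₀ , λ _ _ → z≤n
... | no ¬p₀ with least (P? ∘ suc) L p
...   | l , pl , min = suc l , pl , λ
        { zero    p₀ → contradiction p₀ ¬p₀
        ; (suc j) pj → s≤s (min j pj)
        }

module _ {n : ℕ} {R : Rel (Fin n) 0ℓ} (R? : Decidable R) (r : Fin n) where

  -- Walks of length exactly `l`: for fixed `l` their existence is decidable by searching the
  -- finitely many successors, so a least length can be found.
  Within : ℕ → Fin n → Set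
  Within zero    v = v ≡ r
  Within (suc l) v = ∃[ w ] (R v w × Within l w)

  within? : ∀ l → Unary.Decidable (Within l)
  within? zero    v = v ≟ r
  within? (suc l) v = any? (λ w → R? v w ×-dec within? l w)

  Star⇒Within : ∀ {v} → Star R v r → ∃[ l ] Within l v
  Star⇒Within ε        = zero , refl
  Star⇒Within (e ◅ es) with Star⇒Within es
  ... | l , h = suc l , _ , e , h

  parents : (∀ v → Star R v r) →
            Σ[ d ∈ (Fin n → ℕ) ] (∀ v → v ≢ r → ∃[ w ] (R v w × d w < d v))
  parents conn = d , parent
    where
    shortest : ∀ v → ∃[ l ] (Within l v × ∀ j → Within j v → l ≤ j)
    shortest v with Star⇒Within (conn v)
    ... | L , h = least (λ l → within? l v) L h

    d : Fin n → ℕ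
    d v = proj₁ (shortest v)

    parent : ∀ v → v ≢ r → ∃[ w ] (R v w × d w < d v)
    parent v v≢r with shortest v
    ... | zero  , v≡r         , _ = contradiction v≡r v≢r
    -- `h` is the tail of a shortest walk from `v`, so minimality at `w` gives `d w ≤ l`, while
    -- `d v` is `suc l`.
    ... | suc l , (w , e , h) , _ = w , e , s≤s (proj₂ (proj₂ (shortest w)) l h)

-- Counting ordered pairs of distinct nodes.

module _ {N : ℕ} where

  -- `punchOut` numbers `v` among the `N` nodes other than `u`; this saves the diagonal and yields
  -- the factor `n - 1` in the count.
  offDiagonal : {u v : Fin (suc N)} → u ≢ v → Fin (suc N) × Fin N
  offDiagonal {u} u≢v = u , punchOut u≢v

  offDiagonal-injective : ∀ {u v u′ v′ : Fin (suc N)} (p : u ≢ v) (q : u′ ≢ v′) →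
                          offDiagonal p ≡ offDiagonal q → u ≡ u′ × v ≡ v′
  offDiagonal-injective p q eq with ,-injectiveˡ eq
  ... | refl = refl , punchOut-injective p q (,-injectiveʳ eq)

-- Pigeonhole, after both products are transported along `*↔×`.
×-injective⇒≤ : ∀ {a b c d e} {f : (Fin a × Fin b) × Fin c → Fin d × Fin e} →
                Injective _≡_ _≡_ f → a * b * c ≤ d * e
×-injective⇒≤ inj = injective⇒≤ (Injection.injective
  (↔⇒↣ (↔-sym *↔×) ↣-∘ (mk↣ inj ↣-∘ ↔⇒↣ (↔-trans *↔× (*↔× ×-↔ ↔-refl)))))

-- Color connectedness in terms of color classes.

missing : ∀ {m} (S : Subset m) → ∣ S ∣ < m → ∃[ k ] k ∉ S
missing {m} S ∣S∣<m = ¬∀⟶∃¬ m _ (_∈? S) λ all∈ →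
  <⇒≱ ∣S∣<m (subst (_≤ ∣ S ∣) (∣⊤∣≡n m) (p⊆q⇒∣p∣≤∣q∣ {p = ⊤} (λ {x} _ → all∈ x)))

module _ {n m : ℕ} (G : ColoredEdgeGraph n m) where
  open ColoredEdgeGraph G

  Step : Fin m → Rel (Fin n) 0ℓ
  Step k u v = Σ[ e ∈ Adj u v ] color e ≡ k

  color-irrelevant : ∀ {u v} (e e′ : Adj u v) → color e ≡ color e′
  color-irrelevant e e′ = trans (color-sym e (adj-sym e)) (color-sym (adj-sym e) e′)

  Step-sym : ∀ k → Symmetric (Step k)
  Step-sym k (e , refl) = adj-sym e , color-sym (adj-sym e) e

  step? : ∀ k → Decidable (Step k)
  step? k u v with adj? u v
  ... | no ¬e = no (¬e ∘ proj₁)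
  ... | yes e with color e ≟ k
  ...   | yes c = yes (e , c)
  -- `adj?` supplies only one proof of adjacency; every other proof carries the same color.
  ...   | no ¬c = no λ (e′ , c′) → ¬c (trans (color-irrelevant e e′) c′)

  Step-color : ∀ {k k′ u v} → Step k u v → Step k′ u v → k ≡ k′
  Step-color (e , refl) (e′ , refl) = color-irrelevant e e′

  Step⇒≢ : ∀ {k u v} → Step k u v → u ≢ v
  Step⇒≢ (e , _) u≡v = adj-irrefl u≡v e

  monochromatic : ∀ {k u v} (p : Walk G u v) → All (_≡ k) (colors p) → Star (Step k) u v
  monochromatic nil        []       = ε
  monochromatic (cons e p) (c ∷ cs) = (e , c) ◅ monochromatic p cs

  PathWith : Fin m → Rel (Fin n) 0ℓ
  PathWith k u v = Σ[ p ∈ Walk G u v ] (IsPath p × All (_≡ k) (colors p))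

  suffix : ∀ {k u v w} → ((p , _) : PathWith k v w) → u ∈ nodes p → PathWith k u w
  suffix π@(nil , _)                             (here refl) = π
  suffix π@(cons _ _ , _)                        (here refl) = π
  suffix   (cons _ p , (_ ∷ unique) , (_ ∷ cs)) (there u∈p) = suffix (p , unique , cs) u∈p

  -- Loop erasure: if the new first node already lies on the path, everything before that occurrence
  -- is cut off by `suffix`.
  Star⇒PathWith : ∀ {k u v} → Star (Step k) u v → PathWith k u v
  Star⇒PathWith ε = nil , ([] ∷ []) , []
  Star⇒PathWith {u = u} ((e , c) ◅ es) with Star⇒PathWith es
  ... | π@(p , unique , cs) with DecMembership._∈?_ _≟_ u (nodes p)
  ...   | yes u∈p = suffix π u∈p
  ...   | no  u∉p = cons e p , (¬Any⇒All¬ _ u∉p ∷ unique) , (c ∷ cs)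

  ColorClassesConnected : Set
  ColorClassesConnected = ∀ k u v → Star (Step k) u v

  ColorConnected⇒classes : ∀ {t} → m ≡ t + 1 → ColorConnected t G → ColorClassesConnected
  ColorConnected⇒classes {t} m≡t+1 conn k u v with u ≟ v
  ... | yes refl = ε
  -- All colors but `k` are forbidden, so the path obtained has color `k` throughout.
  ... | no  u≢v with conn u v u≢v (∁ ⁅ k ⁆) ∣∁k∣≡t
    where
    ∣∁k∣≡t : ∣ ∁ ⁅ k ⁆ ∣ ≡ t
    ∣∁k∣≡t = trans (∣∁p∣≡n∸∣p∣ ⁅ k ⁆) (trans (cong₂ _∸_ m≡t+1 (∣⁅x⁆∣≡1 k)) (m+n∸n≡m t 1))
  ...   | p , _ , avoids = monochromatic p (All.map (x∈⁅y⁆⇒x≡y k ∘ x∉∁p⇒x∈p) avoids)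

  -- Some color lies outside `S`, and a path inside its class avoids `S`.
  classes⇒ColorConnected : ∀ {t} → t < m → ColorClassesConnected → ColorConnected t G
  classes⇒ColorConnected t<m conn u v _ S refl with missing S t<m
  ... | k , k∉S with Star⇒PathWith (conn k u v)
  ...   | p , unique , cs = p , unique , All.map (λ { refl → k∉S }) cs

-- Necessity: the edge count.

classes⇒bound : ∀ {N m} (G : ColoredEdgeGraph (suc (suc N)) m) →
                ColorClassesConnected G → 2 * m ≤ suc (suc N)
-- `arc` injects `2 * m * (N + 1)` oriented parent edges into `(N + 2) * (N + 1)` ordered pairs;
-- having at least two nodes makes the factor `N + 1` cancellable.
classes⇒bound {N} {m} G conn = *-cancelʳ-≤ (2 * m) (suc (suc N)) (suc N) (×-injective⇒≤ arc-injective)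
  where
  tree : ∀ k → Σ[ d ∈ (Fin (suc (suc N)) → ℕ) ] (∀ v → v ≢ zero → ∃[ w ] (Step G k v w × d w < d v))
  tree k = parents (step? G k) zero (λ v → conn k v zero)

  depth : Fin m → Fin (suc (suc N)) → ℕ
  depth k = proj₁ (tree k)

  -- The root is `zero`, so `i` stands for the non-root node `suc i`.
  parent : Fin m → Fin (suc N) → Fin (suc (suc N))
  parent k i = proj₁ (proj₂ (tree k) (suc i) λ ())

  parent-step : ∀ k i → Step G k (suc i) (parent k i)
  parent-step k i = proj₁ (proj₂ (proj₂ (tree k) (suc i) λ ()))

  parent-depth : ∀ k i → depth k (parent k i) < depth k (suc i)
  parent-depth k i = proj₂ (proj₂ (proj₂ (tree k) (suc i) λ ()))

  -- The `Fin 2` index is the orientation: `zero` runs from child to parent, `suc zero` back.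
  source target : Fin 2 → Fin m → Fin (suc N) → Fin (suc (suc N))
  source zero       k i = suc i
  source (suc zero) k i = parent k i
  target zero       k i = parent k i
  target (suc zero) k i = suc i

  arc-step : ∀ b k i → Step G k (source b k i) (target b k i)
  arc-step zero       k i = parent-step k i
  arc-step (suc zero) k i = Step-sym G k (parent-step k i)

  arc : (Fin 2 × Fin m) × Fin (suc N) → Fin (suc (suc N)) × Fin (suc N)
  arc ((b , k) , i) = offDiagonal (Step⇒≢ G (arc-step b k i))

  -- Two nodes that are each other's parents would each be strictly closer to the root than the
  -- other. This excludes that one edge is owned by both its ends.
  no-2-cycle : ∀ k {i j} → suc i ≡ parent k j → ¬ parent k i ≡ suc j
  no-2-cycle k {i} {j} i≡pj pi≡j = <-asym (parent-depth k i)
    (subst (_< depth k (parent k i)) (cong (depth k) (sym i≡pj))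
      (subst (depth k (parent k j) <_) (cong (depth k) (sym pi≡j)) (parent-depth k j)))

  ends-injective : ∀ b b′ k {i j} → source b k i ≡ source b′ k j → target b k i ≡ target b′ k j →
                   ((b , k) , i) ≡ ((b′ , k) , j)
  ends-injective zero       zero       k s t = cong ((zero , k) ,_) (suc-injective s)
  ends-injective zero       (suc zero) k s t = contradiction t (no-2-cycle k s)
  ends-injective (suc zero) zero       k s t = contradiction s (no-2-cycle k t)
  ends-injective (suc zero) (suc zero) k s t = cong ((suc zero , k) ,_) (suc-injective t)

  arc-injective : Injective _≡_ _≡_ arc
  arc-injective {(b , k) , i} {(b′ , k′) , j} eq
    with offDiagonal-injective (Step⇒≢ G (arc-step b k i)) (Step⇒≢ G (arc-step b′ k′ j)) eq
  ... | s , t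
    -- Both arcs join the same two nodes, and an edge has only one color, so `k` and `k′` agree.
    with Step-color G (arc-step b k i)
           (subst (λ x → Step G k′ x (target b k i)) (sym s)
             (subst (Step G k′ (source b′ k′ j)) (sym t) (arc-step b′ k′ j)))
  ... | refl = ends-injective b b′ k s t

ColorConnected⇒bound : ∀ {n m t} → 0 < n → 0 < m → m ≡ t + 1 →
                       (G : ColoredEdgeGraph n m) → ColorConnected t G → 2 * m ≤ n
-- Connectedness is vacuous on one node; here surjectivity of the coloring demands an edge, which
-- would be a loop.
ColorConnected⇒bound {1} {suc _} _ _ _ G _ with ColoredEdgeGraph.color-surj G zero
... | (zero , zero , e) , _ = ⊥-elim (ColoredEdgeGraph.adj-irrefl G refl e)
ColorConnected⇒bound {suc (suc N)} _ _ m≡t+1 G conn =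
  classes⇒bound G (ColorConnected⇒classes G m≡t+1 conn)

-- Sufficiency: the double stars.

bit : Parity → ℕ
bit 0ℙ = 0
bit 1ℙ = 1

position : Parity → ℕ → ℕ
position a k = k * 2 + bit a

⌊position/2⌋ : ∀ a k → ⌊ position a k /2⌋ ≡ k
⌊position/2⌋ 0ℙ zero    = refl
⌊position/2⌋ 1ℙ zero    = refl
⌊position/2⌋ a  (suc k) = cong suc (⌊position/2⌋ a k)

parity-position : ∀ a k → parity (position a k) ≡ a
parity-position 0ℙ zero    = refl
parity-position 1ℙ zero    = refl
parity-position a  (suc k) = parity-position a k

position-parity-half : ∀ v → position (parity v) ⌊ v /2⌋ ≡ v
position-parity-half 0             = refl
position-parity-half 1             = refl
position-parity-half (suc (suc v)) = cong (2 +_) (position-parity-half v)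

position< : ∀ a {k m} → k < m → position a k < 2 * m
position< a {k} {m} k<m = ≤-trans (s≤s (+-monoʳ-≤ (k * 2) (bit≤1 a)))
  (≤-trans (≤-reflexive (cong suc (+-comm (k * 2) 1)))
    (≤-trans (*-monoˡ-≤ 2 k<m) (≤-reflexive (*-comm m 2))))
  where
  bit≤1 : ∀ a → bit a ≤ 1
  bit≤1 0ℙ = z≤n
  bit≤1 1ℙ = ≤-refl

pairColor : Parity → Parity → ℕ → ℕ → ℕ
pairColor 0ℙ 0ℙ = _⊓_
pairColor 1ℙ 1ℙ = _⊓_
pairColor 0ℙ 1ℙ = _⊔_
pairColor 1ℙ 0ℙ = _⊔_

pairColor-comm : ∀ a b i j → pairColor a b i j ≡ pairColor b a j i
pairColor-comm 0ℙ 0ℙ = ⊓-comm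
pairColor-comm 1ℙ 1ℙ = ⊓-comm
pairColor-comm 0ℙ 1ℙ = ⊔-comm
pairColor-comm 1ℙ 0ℙ = ⊔-comm

pairColor-same : ∀ a {i j} → j ≤ i → pairColor a a i j ≡ j
pairColor-same 0ℙ = m≥n⇒m⊓n≡n
pairColor-same 1ℙ = m≥n⇒m⊓n≡n

pairColor-opposite : ∀ a {i j} → i ≤ j → pairColor a (a ⁻¹) i j ≡ j
pairColor-opposite 0ℙ = m≤n⇒m⊔n≡n
pairColor-opposite 1ℙ = m≤n⇒m⊔n≡n

module DoubleStars (n m : ℕ) (2m≤n : 2 * m ≤ n) where

  side : Fin n → Parity
  side u = parity (toℕ u)

  half : Fin n → ℕ
  half u = ⌊ toℕ u /2⌋

  edgeColor : Fin n → Fin n → ℕ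
  edgeColor u v = pairColor (side u) (side v) (half u) (half v)

  edgeColor-comm : ∀ u v → edgeColor u v ≡ edgeColor v u
  edgeColor-comm u v = pairColor-comm (side u) (side v) (half u) (half v)

  center : Parity → Fin m → Fin n
  -- This is where `2 * m ≤ n` enters: all `2 * m` centers must be nodes.
  center a k = fromℕ< (≤-trans (position< a (toℕ<n k)) 2m≤n)

  index-center : ∀ a k → toℕ (center a k) ≡ position a (toℕ k)
  index-center a k = toℕ-fromℕ< _

  side-center : ∀ a k → side (center a k) ≡ a
  side-center a k = trans (cong parity (index-center a k)) (parity-position a (toℕ k))

  half-center : ∀ a k → half (center a k) ≡ toℕ k
  half-center a k = trans (cong ⌊_/2⌋ (index-center a k)) (⌊position/2⌋ a (toℕ k))

  edgeColor-center : ∀ v a k → edgeColor v (center a k) ≡ pairColor (side v) a (half v) (toℕ k)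
  edgeColor-center v a k = cong₂ (λ b j → pairColor (side v) b (half v) j) (side-center a k) (half-center a k)

  ≡-center : ∀ v k → half v ≡ toℕ k → v ≡ center (side v) k
  ≡-center v k h≡k = toℕ-injective (trans (sym (position-parity-half (toℕ v)))
    (trans (cong (position (side v)) h≡k) (sym (index-center (side v) k))))

  Adjacent : Rel (Fin n) 0ℓ
  Adjacent u v = u ≢ v × edgeColor u v < m

  Adjacent? : Decidable Adjacent
  Adjacent? u v = ¬? (u ≟ v) ×-dec (edgeColor u v <? m)

  -- The result is what `Step graph k u v` unfolds to, spelled out because `graph` itself takes the
  -- surjectivity of its coloring from `centers-adjacent`.
  colored : ∀ {u v} (k : Fin m) → u ≢ v → edgeColor u v ≡ toℕ k →
            Σ[ e ∈ Adjacent u v ] fromℕ< (proj₂ e) ≡ k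
  colored k u≢v c = (u≢v , subst (_< m) (sym c) (toℕ<n k)) ,
    trans (fromℕ<-cong _ _ c _ (toℕ<n k)) (fromℕ<-toℕ k _)

  centers-adjacent : ∀ k → Σ[ e ∈ Adjacent (center 0ℙ k) (center 1ℙ k) ] fromℕ< (proj₂ e) ≡ k
  centers-adjacent k = colored k distinct
    (trans (edgeColor-center (center 0ℙ k) 1ℙ k)
      (trans (cong₂ (λ a j → pairColor a 1ℙ j (toℕ k)) (side-center 0ℙ k) (half-center 0ℙ k))
        (⊔-idem (toℕ k))))
    where
    distinct : center 0ℙ k ≢ center 1ℙ k
    distinct eq with trans (sym (side-center 0ℙ k)) (trans (cong side eq) (side-center 1ℙ k))
    ... | ()

  graph : ColoredEdgeGraph n m
  graph = record
    { Adj        = Adjacent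
    ; adj?       = Adjacent?
    ; adj-sym    = λ {u} {v} (u≢v , c) → u≢v ∘ sym , subst (_< m) (edgeColor-comm u v) c
    ; adj-irrefl = λ u≡v (u≢v , _) → u≢v u≡v
    ; color      = λ e → fromℕ< (proj₂ e)
    ; color-sym  = λ {u} {v} e e′ → fromℕ<-cong _ _ (edgeColor-comm u v) (proj₂ e) (proj₂ e′)
    ; color-surj = λ k → (center 0ℙ k , center 1ℙ k , proj₁ (centers-adjacent k)) , proj₂ (centers-adjacent k)
    }

  to-some-center : ∀ k v → ∃[ a ] Star (Step graph k) v (center a k)
  to-some-center k v with <-cmp (half v) (toℕ k)
  ... | tri≈ _ h≡k _ = side v , subst (Star (Step graph k) v) (≡-center v k h≡k) ε
  ... | tri< h<k h≢k _ = side v ⁻¹ ,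
    colored k (λ eq → h≢k (trans (cong half eq) (half-center _ k)))
      (trans (edgeColor-center v _ k) (pairColor-opposite (side v) (<⇒≤ h<k))) ◅ ε
  -- Nodes numbered `2 * m` or above fall here for every `k`, since their halves are at least `m`.
  ... | tri> _ h≢k k<h = side v ,
    colored k (λ eq → h≢k (trans (cong half eq) (half-center _ k)))
      (trans (edgeColor-center v _ k) (pairColor-same (side v) (<⇒≤ k<h))) ◅ ε

  to-center : ∀ k v → Star (Step graph k) v (center 1ℙ k)
  to-center k v with to-some-center k v
  ... | 1ℙ , p = p
  -- Crossing the edge between the two centers gives all nodes a common target.
  ... | 0ℙ , p = p ◅◅ (centers-adjacent k ◅ ε)

  classes-connected : ColorClassesConnected graph
  classes-connected k u v = to-center k u ◅◅ reverse (Step-sym graph k) (to-center k v)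

theorem3p4 : (n m t : ℕ) → 0 < n → 0 < m → 0 < t → m ≡ t + 1 →
    (∃[ G ] ColorConnected {n} {m} t G) ⇔ (n ≥ 2 * m)
theorem3p4 n m t 0<n 0<m _ m≡t+1 = mk⇔
  (λ (G , conn) → ColorConnected⇒bound 0<n 0<m m≡t+1 G conn)
  (λ 2m≤n → let open DoubleStars n m 2m≤n in
    graph , classes⇒ColorConnected graph t<m classes-connected)
  where
  t<m : t < m
  t<m = ≤-reflexive (trans (+-comm 1 t) (sym m≡t+1))
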